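{- Every class of graphs with linear cop-width has linear flip-width. That is, if $\mathcal{G}$ is a class of graphs for which there is a constant $c$ such that $\operatorname{cw}_r(G)\le c\,r$ for every $r\in\mathbb{N}$ and every $G\in\mathcal{G}$, then there is a constant $c'$ such that $\operatorname{fw}_r(G)\le c'\,r$ for every $r\in\mathbb{N}$ and every $G\in\mathcal{G}$.
   Context: All graphs are finite, simple and undirected; $\mathbb{N}=\{1,2,\dots\}$. A graph class is closed under isomorphism. Cop-width game with radius $r$ and width $k$ on $G$: initially the cops occupy a set $C_0\subseteq V(G)$ with $|C_0|\le k$ and the robber chooses a vertex $x_0$. In each round $i\ge1$, the cops announce a new set $C_i\subseteq V(G)$ with $|C_i|\le k$; the robber, knowing $C_i$, moves from $x_{i-1}$ to a vertex $x_i$ along a path in $G$ of length at most $r$ containing no vertex of $C_{i-1}\cap C_i$. The robber is caught if $x_i\in C_i$. $\operatorname{cw}_r(G)$ is the least $k\in\mathbb{N}$ such that the cops can guarantee capture in finitely many rounds. Flips: for $A,B\subseteq V(G)$, flipping between $A$ and $B$ inverts the adjacency of every pair $a,b$ with $a\in A$, $b\in B$. For a partition $\mathcal{P}$ of $V(G)$, a $\mathcal{P}$-flip of $G$ is a graph obtained from $G$ by a sequence of flips between pairs of parts $A,B\in\mathcal{P}$ (possibly $A=B$); a $k$-flip of $G$ is a $\mathcal{P}$-flip for some partition $\mathcal{P}$ with $|\mathcal{P}|\le k$. Flip-width game with radius $r$ and width $k$ on $G$: $G_0=G$ and the runner chooses a vertex $x_0$. In each round $i\ge1$ the flipper announces a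 $k$-flip $G_i$ of $G$; the runner, knowing $G_i$, moves from $x_{i-1}$ to a vertex $x_i$ along a path of length at most $r$ in $G_{i-1}$. The game ends (flipper wins) when $x_i$ is an isolated vertex of $G_i$. $\operatorname{fw}_r(G)$ is the least $k\in\mathbb{N}$ such that the flipper has a strategy guaranteeing that the game ends after finitely many rounds. -}

module Defs where

open import Data.Nat using (ℕ; zero; suc; _≤_; _*_)
open import Data.Fin using (Fin; _≟_)
open import Data.Fin.Subset using (Subset; _∈_; _∉_; _∩_; ∣_∣; ⊥)
open import Data.Bool using (Bool; true; false; _xor_; _∧_; _∨_; not)
open import Data.List using (List; foldr)
open import Data.Product using (Σ; _×_; _,_)
open import Data.Sum using (_⊎_)
open import Relation.Nullary.Decidable using (⌊_⌋)
open import Relation.Binary.PropositionalEquality using (_≡_)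
open import Function.Bundles using (_↔_; Inverse)

record Graph : Set where
  field
    n      : ℕ
    adj    : Fin n → Fin n → Bool
    sym    : ∀ u v → adj u v ≡ adj v u
    irrefl : ∀ u → adj u u ≡ false
open Graph public

Iso : Graph → Graph → Set
Iso G H = Σ (Fin (n G) ↔ Fin (n H)) λ f →
  ∀ u v → adj H (Inverse.to f u) (Inverse.to f v) ≡ adj G u v

IsoClosed : (Graph → Set) → Set
IsoClosed 𝒢 = ∀ G H → Iso G H → 𝒢 G → 𝒢 H

data Walk {m : ℕ} (A : Fin m → Fin m → Bool) (S : Subset m)
          : ℕ → Fin m → Fin m → Set where
  stay : ∀ {r x} → x ∉ S → Walk A S r x x
  step : ∀ {r x y z} → x ∉ S → A x y ≡ true →
         Walk A S r y z → Walk A S (suc r) x z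

-- Cop-width game with radius r and width k on G.
-- CopsWin G r k C x : the cops currently occupy C (= C_{i-1}), the robber
-- is at x (= x_{i-1}), and the cops can force capture in finitely many
-- further rounds (inductive = well-founded = finitely many rounds).

data CopsWin (G : Graph) (r k : ℕ) : Subset (n G) → Fin (n G) → Set where
  move : ∀ {C x} (C' : Subset (n G)) → ∣ C' ∣ ≤ k →
         (∀ x' → Walk (adj G) (C ∩ C') r x x' →
                 x' ∈ C' ⊎ CopsWin G r k C' x') →
         CopsWin G r k C x

CopsWinGame : Graph → ℕ → ℕ → Set
CopsWinGame G r k =
  Σ (Subset (n G)) λ C₀ → ∣ C₀ ∣ ≤ k × (∀ x₀ → CopsWin G r k C₀ x₀)

-- cw_r(G) ≤ m : the least k ∈ {1,2,...} for which the cops win is ≤ m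
cw≤ : ℕ → Graph → ℕ → Set
cw≤ r G m = Σ ℕ λ k → 1 ≤ k × k ≤ m × CopsWinGame G r k

-- flipping between A and B (vertex sets given as Bool predicates):
-- inverts adjacency of every pair {a,b}, a ∈ A, b ∈ B (a ≠ b, graphs simple)
flipBetween : {m : ℕ} → (Fin m → Bool) → (Fin m → Bool) →
              (Fin m → Fin m → Bool) → (Fin m → Fin m → Bool)
flipBetween A B E u v =
  E u v xor (not ⌊ u ≟ v ⌋ ∧ ((A u ∧ B v) ∨ (B u ∧ A v)))

-- A partition with at most k parts is given by a map p : Fin m → Fin k
-- (parts = nonempty fibres). Part i as a vertex set:
part : {m k : ℕ} → (Fin m → Fin k) → Fin k → Fin m → Bool
part p i u = ⌊ p u ≟ i ⌋

applyFlips : {m k : ℕ} → (Fin m → Fin k) → List (Fin k × Fin k) →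
             (Fin m → Fin m → Bool) → (Fin m → Fin m → Bool)
applyFlips p fs E =
  foldr (λ { (i , j) E' → flipBetween (part p i) (part p j) E' }) E fs

Isolated : {m : ℕ} → (Fin m → Fin m → Bool) → Fin m → Set
Isolated E x = ∀ y → E x y ≡ false

-- Flip-width game with radius r and width k on G.
-- FlipperWins G r k H x : current graph is H (= G_{i-1}), runner at
-- x (= x_{i-1}); flipper can force the game to end in finitely many rounds.
-- The flipper announces a k-flip G_i = applyFlips p fs (adj G) of G.

data FlipperWins (G : Graph) (r k : ℕ)
     : (Fin (n G) → Fin (n G) → Bool) → Fin (n G) → Set where
  move : ∀ {H x} (p : Fin (n G) → Fin k) (fs : List (Fin k × Fin k)) →
         (∀ x' → Walk H ⊥ r x x' →
                 Isolated (applyFlips p fs (adj G)) x' ⊎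
                 FlipperWins G r k (applyFlips p fs (adj G)) x') →
         FlipperWins G r k H x

FlipperWinsGame : Graph → ℕ → ℕ → Set
FlipperWinsGame G r k = ∀ x₀ → FlipperWins G r k (adj G) x₀

fw≤ : ℕ → Graph → ℕ → Set
fw≤ r G m = Σ ℕ λ k → 1 ≤ k × k ≤ m × FlipperWinsGame G r k

{-# OPTIONS --safe #-}
-- The flipper imitates the cops: with a part for every vertex of the cop set C
-- and a part for every trace N(v) ∩ C of a vertex v outside C, suitable flips
-- delete exactly the edges meeting C.  It remains to see that C has only
-- O(|C|) traces, with a constant depending on the number k of cops winning the
-- game of radius 2.  Going once through the vertices v ∉ C, whenever the trace
-- of v contains a pair not yet joined in an auxiliary graph on C, join one such
-- pair and remember v as its midpoint.  Every nonempty subset of C contains a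
-- vertex with fewer than k auxiliary neighbours in it, since otherwise the
-- robber escapes forever along the length-2 paths through midpoints.  Peeling
-- off such vertices one by one, each accounts for fewer than k midpoints and
-- for at most 2^k cliques; and the trace of a vertex that is not a midpoint is
-- a clique.
module Submission where

open import Defs renaming (sym to adj-sym)
open import Data.Bool using (Bool; true; false; not; _∧_; _∨_; _xor_)
open import Data.Bool.Properties using (∧-comm; ∨-comm; ∧-zeroʳ; ∧-distribˡ-xor; xor-assoc; xor-identityʳ; xor-same; ¬-not) renaming (_≟_ to _≟ᵇ_)
open import Data.Empty using (⊥-elim)
open import Data.Fin using (Fin; zero; suc; _≟_)
open import Data.Fin.Properties using (any?)
open import Data.Fin.Subset using (Subset; _∈_; _∉_; _⊆_; _∩_; _∪_; _─_; _-_; ⁅_⁆; ∣_∣; ⊥; inside; outside)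
open import Data.Fin.Subset.Properties using (_∈?_; nonempty?; Empty-unique; x∈⁅x⁆; x∈⁅y⁆⇒x≡y; ⊆-antisym; p─q⊆p; x∈p∩q⁺; x∈p∩q⁻; x∈p∪q⁺; x∈p∪q⁻; x∈p∧x≢y⇒x∈p-y; x∈p⇒∣p-x∣<∣p∣)
open import Data.List using (List; []; _∷_; _++_; map; filter; length; allFin; cartesianProduct)
open import Data.List.Properties using (length-map; length-++)
open import Data.List.Membership.Propositional using (find; lose) renaming (_∈_ to _∈ˡ_)
open import Data.List.Membership.Propositional.Properties using (∈-map⁺; ∈-++⁺ˡ; ∈-++⁺ʳ; ∈-filter⁺; ∈-filter⁻; ∈-allFin; ∈-cartesianProduct⁺)
open import Data.List.Relation.Unary.All as All using (All; []; _∷_)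
open import Data.List.Relation.Unary.All.Properties using (¬Any⇒All¬; all-filter)
open import Data.List.Relation.Unary.AllPairs as AllPairs using (AllPairs; []; _∷_)
import Data.List.Relation.Unary.AllPairs.Properties as AllPairs
open import Data.List.Relation.Unary.Any as Any using (Any; here; there)
open import Data.List.Relation.Unary.Unique.Propositional using (Unique)
import Data.List.Relation.Unary.Unique.Propositional.Properties as Unique
open import Data.Nat using (ℕ; zero; suc; _+_; _*_; _^_; _≤_; _<_; z≤n; s≤s; s≤s⁻¹; _<?_)
open import Data.Nat.Properties using (≤-refl; ≤-trans; ≤-reflexive; <-≤-trans; <⇒≤; <⇒≱; ≮⇒≥; +-mono-≤; *-mono-≤; ^-monoʳ-≤; m≤m+n; +-suc; +-identityʳ; module ≤-Reasoning)
open import Data.Nat.Solver using (module +-*-Solver)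
open import Data.Product using (Σ; ∃; _×_; _,_; proj₁; proj₂)
open import Data.Sum using (_⊎_; inj₁; inj₂)
open import Data.Vec using ([]; _∷_; lookup; tabulate; here; there)
open import Data.Vec.Properties using ([]=⇒lookup; lookup⇒[]=; lookup∘tabulate)
import Data.Vec.Functional as Vector
open import Relation.Binary.PropositionalEquality using (_≡_; _≢_; refl; sym; trans; cong; cong₂; subst)
open import Relation.Nullary using (Dec; yes; no; ¬_; contradiction)
open import Relation.Nullary.Decidable using (⌊_⌋; _×-dec_; _⊎-dec_; ¬?; decidable-stable)

-- Finite sets

x∈p─q⇒x∉q : ∀ {m} {x : Fin m} (p q : Subset m) → x ∈ p ─ q → x ∉ q
x∈p─q⇒x∉q (_ ∷ p) (outside ∷ q) (there x∈) (there x∈q) = x∈p─q⇒x∉q p q x∈ x∈q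
x∈p─q⇒x∉q (_ ∷ p) (inside ∷ q)  (there x∈) (there x∈q) = x∈p─q⇒x∉q p q x∈ x∈q

x∈p-y⇒x≢y : ∀ {m} {x y : Fin m} (p : Subset m) → x ∈ p - y → x ≢ y
x∈p-y⇒x≢y p x∈ refl = x∈p─q⇒x∉q p _ x∈ (x∈⁅x⁆ _)

p-x⊆p : ∀ {m} (p : Subset m) (x : Fin m) → p - x ⊆ p
p-x⊆p p x = p─q⊆p p ⁅ x ⁆

⁅x⁆∪[p-x]≡p : ∀ {m} {x : Fin m} {p : Subset m} → x ∈ p → ⁅ x ⁆ ∪ (p - x) ≡ p
⁅x⁆∪[p-x]≡p {x = x} {p} x∈p = ⊆-antisym ⊆p p⊆
  where
  ⊆p : ⁅ x ⁆ ∪ (p - x) ⊆ p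
  ⊆p y∈ with x∈p∪q⁻ ⁅ x ⁆ (p - x) y∈
  ... | inj₁ y∈⁅x⁆ rewrite x∈⁅y⁆⇒x≡y x y∈⁅x⁆ = x∈p
  ... | inj₂ y∈p-x = p-x⊆p p x y∈p-x
  p⊆ : p ⊆ ⁅ x ⁆ ∪ (p - x)
  p⊆ {y} y∈p with y ≟ x
  ... | yes refl = x∈p∪q⁺ (inj₁ (x∈⁅x⁆ x))
  ... | no y≢x   = x∈p∪q⁺ (inj₂ (x∈p∧x≢y⇒x∈p-y y∈p y≢x))

-- Induction on the list: the point `c` hit by the head can be hit by no later entry, so the tail
-- hits within `S - c`. The relation `R` will be inequality of vertices, and `Apart` for auxiliary
-- edges.
pigeonhole : ∀ {m} {A : Set} {R : A → A → Set} (Hits : A → Fin m → Set) →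
             (∀ {a b c} → Hits a c → Hits b c → ¬ R a b) →
             ∀ {as} → AllPairs R as → (S : Subset m) →
             All (λ a → ∃ λ c → c ∈ S × Hits a c) as → length as ≤ ∣ S ∣
pigeonhole Hits apart [] S [] = z≤n
pigeonhole Hits apart (Ra ∷ Ras) S ((c , c∈S , hit) ∷ hits) =
  ≤-trans (s≤s (pigeonhole Hits apart Ras (S - c) (All.zipWith avoid-c (Ra , hits))))
          (x∈p⇒∣p-x∣<∣p∣ c∈S)
  where
  avoid-c : ∀ {b} → _ × (∃ λ d → d ∈ S × Hits b d) → ∃ λ d → d ∈ S - c × Hits b d
  avoid-c (Rab , d , d∈S , hit′) =
    d , x∈p∧x≢y⇒x∈p-y d∈S (λ { refl → apart hit hit′ Rab }) , hit′

Unique⇒length≤∣∣ : ∀ {m} {xs : List (Fin m)} → Unique xs → (S : Subset m) →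
                   All (_∈ S) xs → length xs ≤ ∣ S ∣
Unique⇒length≤∣∣ xs! S xs⊆S =
  pigeonhole _≡_ (λ { refl refl x≢x → x≢x refl }) xs! S
    (All.map (λ x∈S → _ , x∈S , refl) xs⊆S)

members : ∀ {m} → Subset m → List (Fin m)
members S = filter (_∈? S) (allFin _)

length-members : ∀ {m} (S : Subset m) → length (members S) ≤ ∣ S ∣
length-members S =
  Unique⇒length≤∣∣ (Unique.filter⁺ (_∈? S) (Unique.allFin⁺ _)) S (all-filter (_∈? S) (allFin _))

∈-members⁺ : ∀ {m} {S : Subset m} {x} → x ∈ S → x ∈ˡ members S
∈-members⁺ {S = S} x∈S = ∈-filter⁺ (_∈? S) (∈-allFin _) x∈S

subsets : ∀ {m} → List (Fin m) → List (Subset m)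
subsets []       = ⊥ ∷ []
subsets (x ∷ xs) = map (⁅ x ⁆ ∪_) (subsets xs) ++ subsets xs

length-subsets : ∀ {m} (xs : List (Fin m)) → length (subsets xs) ≡ 2 ^ length xs
length-subsets []       = refl
length-subsets (x ∷ xs) = trans (length-++ (map (⁅ x ⁆ ∪_) (subsets xs)))
  (cong₂ _+_ (trans (length-map _ (subsets xs)) (length-subsets xs))
             (trans (length-subsets xs) (sym (+-identityʳ _))))

∈-subsets⁺ : ∀ {m} (xs : List (Fin m)) (t : Subset m) →
             (∀ {x} → x ∈ t → x ∈ˡ xs) → t ∈ˡ subsets xs
∈-subsets⁺ [] t t⊆ = here (Empty-unique λ (x , x∈t) → contradiction (t⊆ x∈t) λ ())
∈-subsets⁺ (x ∷ xs) t t⊆ with x ∈? t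
... | yes x∈t = ∈-++⁺ˡ (subst (_∈ˡ _) (⁅x⁆∪[p-x]≡p x∈t)
                  (∈-map⁺ (⁅ x ⁆ ∪_) (∈-subsets⁺ xs (t - x) t-x⊆)))
  where
  t-x⊆ : ∀ {y} → y ∈ t - x → y ∈ˡ xs
  t-x⊆ y∈ = Any.tail (x∈p-y⇒x≢y t y∈) (t⊆ (p-x⊆p t x y∈))
... | no x∉t = ∈-++⁺ʳ (map (⁅ x ⁆ ∪_) (subsets xs))
                 (∈-subsets⁺ xs t λ y∈ → Any.tail (λ { refl → x∉t y∈ }) (t⊆ y∈))

enumerate : ∀ {A : Set} {k} → A → (L : List A) → length L ≤ k →
            Σ (Fin k → A) λ f → ∀ {a} → a ∈ˡ L → ∃ λ i → f i ≡ a
-- The default `d` fills the surplus indices when `k` exceeds the length of the list.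
enumerate d []      _         = (λ _ → d) , λ ()
enumerate d (a ∷ L) (s≤s L≤k) with enumerate d L L≤k
... | f , f-onto = a Vector.∷ f , λ
  { (here refl) → zero , refl
  ; (there b∈L) → let i , fi≡b = f-onto b∈L in suc i , fi≡b }

-- Counting traces

module Traces (G : Graph) (C : Subset (n G)) where

  V : Set
  V = Fin (n G)

  trace : V → Subset (n G)
  trace v = tabulate (adj G v) ∩ C

  ∈-trace⁻ : ∀ {v a} → a ∈ trace v → adj G v a ≡ true × a ∈ C
  ∈-trace⁻ {v} {a} a∈ with x∈p∩q⁻ (tabulate (adj G v)) C a∈
  ... | a∈N , a∈C = trans (sym (lookup∘tabulate (adj G v) a)) ([]=⇒lookup a∈N) , a∈C

  ∈-trace⁺ : ∀ {v a} → adj G v a ≡ true → a ∈ C → a ∈ trace v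
  ∈-trace⁺ {v} {a} va a∈C =
    x∈p∩q⁺ (lookup⇒[]= a _ (trans (lookup∘tabulate (adj G v) a) va) , a∈C)

  -- The auxiliary graph on the cop set, with midpoints.

  record Edge : Set where
    constructor edge
    field
      end₁ end₂ mid : V
  open Edge

  Link : V → V → Edge → Set
  Link x y e = (end₁ e ≡ x × end₂ e ≡ y) ⊎ (end₁ e ≡ y × end₂ e ≡ x)

  link? : ∀ x y e → Dec (Link x y e)
  link? x y e = ((end₁ e ≟ x) ×-dec (end₂ e ≟ y)) ⊎-dec ((end₁ e ≟ y) ×-dec (end₂ e ≟ x))

  Valid : Edge → Set
  Valid e = end₁ e ∈ trace (mid e) × end₂ e ∈ trace (mid e) × end₁ e ≢ end₂ e × mid e ∉ C

  -- Required pairwise, this excludes parallel edges and gives each edge a midpoint of its own.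
  Apart : Edge → Edge → Set
  Apart e e′ = mid e ≢ mid e′ × ¬ Link (end₁ e) (end₂ e) e′

  Joined : List Edge → V → V → Set
  Joined E x y = Any (Link x y) E

  Clique : List Edge → Subset (n G) → Set
  Clique E t = ∀ {x y} → x ∈ t → y ∈ t → x ≢ y → Joined E x y

  Unjoined : List Edge → V → V → V → Set
  Unjoined E v x y = x ∈ trace v × y ∈ trace v × x ≢ y × ¬ Joined E x y

  unjoined? : ∀ E v → Dec (∃ λ x → ∃ λ y → Unjoined E v x y)
  unjoined? E v = any? λ x → any? λ y →
    (x ∈? trace v) ×-dec (y ∈? trace v) ×-dec ¬? (x ≟ y) ×-dec ¬? (Any.any? (link? x y) E)

  record Saturated (vs : List V) (E : List Edge) : Set where
    field
      valid    : All Valid E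
      apart    : AllPairs Apart E
      mids     : All (λ e → mid e ∈ˡ vs) E
      complete : ∀ {v} → v ∈ˡ vs → v ∉ C → Any (λ e → mid e ≡ v) E ⊎ Clique E (trace v)

  -- The tail is treated first, so by uniqueness and `mids` the vertex `v` is not yet a midpoint.
  -- Adding an edge never destroys a clique, hence what `complete` records for the other vertices
  -- persists.
  saturate : ∀ vs → Unique vs → ∃ (Saturated vs)
  saturate [] _ = [] , record { valid = [] ; apart = [] ; mids = [] ; complete = λ () }
  saturate (v ∷ vs) (v∉ ∷ vs!) with saturate vs vs!
  ... | E , S = extend (v ∈? C) (unjoined? E v)
    where
    open Saturated S
    extend : Dec (v ∈ C) → Dec (∃ λ x → ∃ λ y → Unjoined E v x y) → ∃ (Saturated (v ∷ vs))
    extend (yes v∈C) _ = E , record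
      { valid = valid ; apart = apart ; mids = All.map there mids
      ; complete = λ { (here refl) v∉C → contradiction v∈C v∉C ; (there w∈) → complete w∈ } }
    extend (no v∉C) (no allJoined) = E , record
      { valid = valid ; apart = apart ; mids = All.map there mids
      ; complete = λ { (here refl) _ → inj₂ clique ; (there w∈) → complete w∈ } }
      where
      clique : Clique E (trace v)
      clique {x} {y} x∈ y∈ x≢y = decidable-stable (Any.any? (link? x y) E)
        λ ¬xy → allJoined (x , y , x∈ , y∈ , x≢y , ¬xy)
    extend (no v∉C) (yes (x , y , x∈ , y∈ , x≢y , ¬xy)) = edge x y v ∷ E , record
      { valid = (x∈ , y∈ , x≢y , v∉C) ∷ valid
      ; apart = All.zipWith (λ (mid∈ , ¬link) → (λ { refl → All.lookup v∉ mid∈ refl }) , ¬link)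
                  (mids , ¬Any⇒All¬ E ¬xy) ∷ apart
      ; mids = here refl ∷ All.map there mids
      ; complete = complete′ }
      where
      complete′ : ∀ {w} → w ∈ˡ v ∷ vs → w ∉ C →
                  Any (λ e → mid e ≡ w) (edge x y v ∷ E) ⊎ Clique (edge x y v ∷ E) (trace w)
      complete′ (here refl) _ = inj₁ (here refl)
      complete′ (there w∈) w∉C with complete w∈ w∉C
      ... | inj₁ isMid  = inj₁ (there isMid)
      ... | inj₂ clique = inj₂ λ a∈ b∈ a≢b → there (clique a∈ b∈ a≢b)

  Incident : Subset (n G) → V → Edge → Set
  Incident X x e = ∃ λ y → y ∈ X × x ≢ y × Link x y e

  incident? : ∀ X x e → Dec (Incident X x e)
  incident? X x e = any? λ y → (y ∈? X) ×-dec ¬? (x ≟ y) ×-dec link? x y e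

  -- For pairwise apart edges its length is the number of auxiliary neighbours of `x` in `X`.
  star : List Edge → Subset (n G) → V → List Edge
  star E X x = filter (incident? X x) E

  far : V → Edge → V
  far x e with end₁ e ≟ x
  ... | yes _ = end₂ e
  ... | no _  = end₁ e

  far-link : ∀ {x y e} → x ≢ y → Link x y e → far x e ≡ y
  far-link {x} {y} {e} x≢y link with end₁ e ≟ x | link
  ... | yes _    | inj₁ (_ , e₂≡y)  = e₂≡y
  ... | no e₁≢x  | inj₁ (e₁≡x , _)  = contradiction e₁≡x e₁≢x
  ... | yes e₁≡x | inj₂ (e₁≡y , _)  = contradiction (trans (sym e₁≡x) e₁≡y) x≢y
  ... | no _     | inj₂ (e₁≡y , _)  = e₁≡y

  link-via-mid : ∀ {x y e} → Valid e → Link x y e →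
                 adj G x (mid e) ≡ true × adj G (mid e) y ≡ true
  link-via-mid (e₁∈ , e₂∈ , _) (inj₁ (refl , refl)) =
    trans (adj-sym G _ _) (proj₁ (∈-trace⁻ e₁∈)) , proj₁ (∈-trace⁻ e₂∈)
  link-via-mid (e₁∈ , e₂∈ , _) (inj₂ (refl , refl)) =
    trans (adj-sym G _ _) (proj₁ (∈-trace⁻ e₂∈)) , proj₁ (∈-trace⁻ e₁∈)

  link-unique : ∀ {x y e e′} → Link x y e → Link x y e′ → Link (end₁ e) (end₂ e) e′
  link-unique (inj₁ (refl , refl)) l        = l
  link-unique (inj₂ (refl , refl)) (inj₁ l) = inj₂ l
  link-unique (inj₂ (refl , refl)) (inj₂ l) = inj₁ l

  -- Evading the cops, and peeling off sparse vertices.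

  module Peeling {vs E} (S : Saturated vs E) {k} (cops : CopsWinGame G 2 k) where
    open Saturated S

    -- Midpoints lie outside C and ends inside, so a cop blocks at most one edge at x.
    Blocks : V → Edge → V → Set
    Blocks x e c = (c ≡ mid e × c ∉ C) ⊎ (c ∈ C × Link x c e)

    blocks-apart : ∀ {x e e′ c} → Blocks x e c → Blocks x e′ c → ¬ Apart e e′
    blocks-apart (inj₁ (p , _))   (inj₁ (q , _))   (≢mid , _)  = ≢mid (trans (sym p) q)
    blocks-apart (inj₁ (_ , c∉C)) (inj₂ (c∈C , _)) _           = c∉C c∈C
    blocks-apart (inj₂ (c∈C , _)) (inj₁ (_ , c∉C)) _           = c∉C c∈C
    blocks-apart {e = e} {e′} (inj₂ (_ , l)) (inj₂ (_ , l′)) (_ , ¬link) = ¬link (link-unique {e = e} {e′} l l′)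

    module _ (X : Subset (n G)) (X⊆C : X ⊆ C)
             (dense : ∀ {x} → x ∈ X → k ≤ length (star E X x)) where

      Free : Subset (n G) → V → Edge → Set
      Free D x e = mid e ∉ D × ∃ λ y → y ∉ D × y ∈ X × Link x y e

      free? : ∀ D x e → Dec (Free D x e)
      free? D x e = ¬? (mid e ∈? D) ×-dec any? λ y → ¬? (y ∈? D) ×-dec (y ∈? X) ×-dec link? x y e

      -- The blocker is never `x`: a midpoint lies outside `C` while `x` lies inside, and the far
      -- end differs from `x`. So a cop on `x` blocks nothing, which is the one cop that `escape`
      -- has to save.
      ¬free⇒blocked : ∀ {D x e} → x ∈ X → Valid e → Incident X x e → ¬ Free D x e →
                      ∃ λ c → c ∈ D - x × Blocks x e c
      ¬free⇒blocked {D} {x} {e} x∈X (_ , _ , _ , mid∉C) (y , y∈X , x≢y , link) ¬free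
        with mid e ∈? D | y ∈? D
      ... | yes mid∈D | _ = mid e ,
              x∈p∧x≢y⇒x∈p-y mid∈D (λ mid≡x → mid∉C (subst (_∈ C) (sym mid≡x) (X⊆C x∈X))) ,
              inj₁ (refl , mid∉C)
      ... | no _      | yes y∈D = y , x∈p∧x≢y⇒x∈p-y y∈D (λ y≡x → x≢y (sym y≡x)) , inj₂ (X⊆C y∈X , link)
      ... | no mid∉D  | no y∉D  = contradiction (mid∉D , y , y∉D , y∈X , link) ¬free

      -- If `D` misses `x`, staying works. Otherwise fewer than `k` cops remain in `D - x`, each
      -- blocks at most one of the at least `k` edges at `x`, and some edge has its midpoint and far
      -- end outside `D`. The set `B` stands for the previous cop position, which leaves `x` free.
      escape : ∀ {x} → x ∈ X → (D : Subset (n G)) → ∣ D ∣ ≤ k →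
               ∃ λ y → y ∈ X × y ∉ D × (∀ {B} → x ∉ B → Walk (adj G) (B ∩ D) 2 x y)
      escape {x} x∈X D ∣D∣≤k with x ∈? D | Any.any? (free? D x) (star E X x)
      ... | no x∉D  | _ = x , x∈X , x∉D , λ {B} x∉B → stay (λ x∈ → x∉B (proj₁ (x∈p∩q⁻ B D x∈)))
      ... | yes _   | yes someFree
        with e , e∈star , mid∉D , y , y∉D , y∈X , link ← find someFree
        with e∈E , _ ← ∈-filter⁻ (incident? X x) {xs = E} e∈star
        with xm , my ← link-via-mid (All.lookup valid e∈E) link =
        y , y∈X , y∉D , λ {B} x∉B →
          step (λ x∈ → x∉B (proj₁ (x∈p∩q⁻ B D x∈))) xm
            (step (λ m∈ → mid∉D (proj₂ (x∈p∩q⁻ B D m∈))) my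
              (stay (λ y∈ → y∉D (proj₂ (x∈p∩q⁻ B D y∈)))))
      ... | yes x∈D | no noneFree = contradiction (dense x∈X)
              (<⇒≱ (<-≤-trans (≤-trans (s≤s fewEdges) (x∈p⇒∣p-x∣<∣p∣ x∈D)) ∣D∣≤k))
        where
        allBlocked : All (λ e → ∃ λ c → c ∈ D - x × Blocks x e c) (star E X x)
        allBlocked = All.tabulate λ {e} e∈star →
          let e∈E , inc = ∈-filter⁻ (incident? X x) {xs = E} e∈star
          in ¬free⇒blocked x∈X (All.lookup valid e∈E) inc (λ free → noneFree (lose e∈star free))
        fewEdges : length (star E X x) ≤ ∣ D - x ∣
        fewEdges = pigeonhole (Blocks x) blocks-apart
          (AllPairs.filter⁺ (incident? X x) apart) (D - x) allBlocked

      -- The robber keeps to vertices of `X` off the current cops. The recursion follows the winning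
      -- tree of the cops, which is well-founded, so endless evasion refutes it.
      robber-survives : ∀ {B x} → x ∈ X → x ∉ B → ¬ CopsWin G 2 k B x
      robber-survives x∈X x∉B (move D ∣D∣≤k next) with escape x∈X D ∣D∣≤k
      ... | y , y∈X , y∉D , walk with next y (walk x∉B)
      ...   | inj₁ y∈D  = y∉D y∈D
      ...   | inj₂ wins = robber-survives y∈X y∉D wins

      dense⇒empty : ∀ {x} → x ∉ X
      dense⇒empty x∈X =
        let C₀ , ∣C₀∣≤k , wins = cops
            -- The walk is dropped: only a starting vertex in `X` that `C₀` leaves free is wanted.
            y , y∈X , y∉C₀ , _ = escape x∈X C₀ ∣C₀∣≤k
        in robber-survives y∈X y∉C₀ (wins y)

    sparse-vertex : ∀ {X} → X ⊆ C → ∀ {z} → z ∈ X → ∃ λ x → x ∈ X × length (star E X x) < k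
    sparse-vertex {X} X⊆C z∈X = decidable-stable
      (any? λ x → (x ∈? X) ×-dec (length (star E X x) <? k))
      λ none → dense⇒empty X X⊆C (λ {x} x∈X → ≮⇒≥ λ lt → none (x , x∈X , lt)) z∈X

    Covers : Subset (n G) → List (Subset (n G)) → Set
    Covers X T = (∀ {e} → e ∈ˡ E → end₁ e ∈ X → end₂ e ∈ X → trace (mid e) ∈ˡ T) ×
                 (∀ {t} → t ⊆ X → Clique E t → t ∈ˡ T)

    -- Removing a sparse `x` loses fewer than `k` midpoints and the cliques through `x`, each of
    -- which is `x` together with some of its fewer than `k` neighbours. A removal thus costs at
    -- most `k + 2 ^ k` sets. The bound `N` makes the recursion structural.
    covering : ∀ N X → X ⊆ C → ∣ X ∣ ≤ N →
               ∃ λ T → length T ≤ suc (N * (k + 2 ^ k)) × Covers X T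
    covering N X X⊆C ∣X∣≤N with nonempty? X
    -- The empty clique is all that remains; it accounts for the `suc` in the bound.
    ... | no empty = ⊥ ∷ [] , s≤s z≤n ,
            (λ _ e₁∈ _ → ⊥-elim (empty (_ , e₁∈))) ,
            (λ t⊆X _ → here (Empty-unique λ (x , x∈t) → empty (x , t⊆X x∈t)))
    ... | yes (z , z∈X) with x , x∈X , deg<k ← sparse-vertex X⊆C z∈X = peel N ∣X∣≤N
      where
      st : List Edge
      st = star E X x

      midTraces cliques : List (Subset (n G))
      midTraces = map (λ e → trace (mid e)) st
      cliques   = map (⁅ x ⁆ ∪_) (subsets (map (far x) st))

      length-cliques : length cliques ≡ 2 ^ length st
      length-cliques = trans (length-map _ (subsets (map (far x) st)))
        (trans (length-subsets (map (far x) st)) (cong (2 ^_) (length-map (far x) st)))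

      length-new : length (midTraces ++ cliques) ≤ k + 2 ^ k
      length-new = ≤-trans (≤-reflexive (length-++ midTraces))
        (+-mono-≤ (≤-trans (≤-reflexive (length-map _ st)) (<⇒≤ deg<k))
                  (≤-trans (≤-reflexive length-cliques) (^-monoʳ-≤ 2 (<⇒≤ deg<k))))

      ∈-star : ∀ {e y} → e ∈ˡ E → y ∈ X → x ≢ y → Link x y e → e ∈ˡ st
      ∈-star e∈E y∈X x≢y link = ∈-filter⁺ (incident? X x) e∈E (_ , y∈X , x≢y , link)

      peel : ∀ N → ∣ X ∣ ≤ N → ∃ λ T → length T ≤ suc (N * (k + 2 ^ k)) × Covers X T
      peel zero    ∣X∣≤N = contradiction (<-≤-trans (x∈p⇒∣p-x∣<∣p∣ x∈X) ∣X∣≤N) λ ()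
      peel (suc N) ∣X∣≤N
        with T , length-T , coversMids , coversCliques ← covering N (X - x) (λ y∈ → X⊆C (p-x⊆p X x y∈))
               (s≤s⁻¹ (≤-trans (x∈p⇒∣p-x∣<∣p∣ x∈X) ∣X∣≤N)) =
        (midTraces ++ cliques) ++ T ,
        ≤-trans (≤-reflexive (length-++ (midTraces ++ cliques)))
          (≤-trans (+-mono-≤ length-new length-T) (≤-reflexive (+-suc _ _))) ,
        mids′ , cliques′
        where
        mids′ : ∀ {e} → e ∈ˡ E → end₁ e ∈ X → end₂ e ∈ X →
                trace (mid e) ∈ˡ (midTraces ++ cliques) ++ T
        mids′ {e} e∈E e₁∈X e₂∈X with end₁ e ≟ x | end₂ e ≟ x | All.lookup valid e∈E
        ... | yes refl | _ | _ , _ , e₁≢e₂ , _ =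
                ∈-++⁺ˡ (∈-++⁺ˡ (∈-map⁺ _ (∈-star e∈E e₂∈X e₁≢e₂ (inj₁ (refl , refl)))))
        ... | no e₁≢x | yes refl | _ =
                ∈-++⁺ˡ (∈-++⁺ˡ (∈-map⁺ _ (∈-star e∈E e₁∈X (λ p → e₁≢x (sym p)) (inj₂ (refl , refl)))))
        ... | no e₁≢x | no e₂≢x | _ = ∈-++⁺ʳ (midTraces ++ cliques)
                (coversMids e∈E (x∈p∧x≢y⇒x∈p-y e₁∈X e₁≢x) (x∈p∧x≢y⇒x∈p-y e₂∈X e₂≢x))

        cliques′ : ∀ {t} → t ⊆ X → Clique E t → t ∈ˡ (midTraces ++ cliques) ++ T
        cliques′ {t} t⊆X clique with x ∈? t
        ... | no x∉t = ∈-++⁺ʳ (midTraces ++ cliques) (coversCliques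
                (λ y∈t → x∈p∧x≢y⇒x∈p-y (t⊆X y∈t) λ { refl → x∉t y∈t }) clique)
        ... | yes x∈t = ∈-++⁺ˡ (∈-++⁺ʳ midTraces (subst (_∈ˡ cliques) (⁅x⁆∪[p-x]≡p x∈t)
                (∈-map⁺ (⁅ x ⁆ ∪_) (∈-subsets⁺ (map (far x) st) (t - x) isFar))))
          where
          isFar : ∀ {y} → y ∈ t - x → y ∈ˡ map (far x) st
          isFar {y} y∈ with y∈t ← p-x⊆p t x y∈ | x≢y ← (λ x≡y → x∈p-y⇒x≢y t y∈ (sym x≡y))
            with e , e∈E , link ← find (clique x∈t y∈t x≢y) =
            subst (_∈ˡ _) (far-link {e = e} x≢y link)
              (∈-map⁺ (far x) (∈-star e∈E (t⊆X y∈t) x≢y link))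

  -- Take `X = C` in `covering`: all ends and all traces lie in `C`, and `complete` makes each
  -- vertex outside `C` a midpoint or its trace a clique.
  few-traces : ∀ {k} → CopsWinGame G 2 k →
               ∃ λ T → length T ≤ suc (∣ C ∣ * (k + 2 ^ k)) × (∀ {v} → v ∉ C → trace v ∈ˡ T)
  few-traces {k} cops with saturate (allFin (n G)) (Unique.allFin⁺ (n G))
  ... | E , S with Peeling.covering S cops ∣ C ∣ C (λ x∈C → x∈C) ≤-refl
  ...   | T , length-T , coversMids , coversCliques = T , length-T , covered
    where
    open Saturated S
    covered : ∀ {v} → v ∉ C → trace v ∈ˡ T
    covered {v} v∉C with complete (∈-allFin v) v∉C
    ... | inj₂ clique = coversCliques (λ a∈ → proj₂ (∈-trace⁻ a∈)) clique
    ... | inj₁ isMid with e , e∈E , refl ← find isMid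
      with e₁∈ , e₂∈ , _ ← All.lookup valid e∈E =
      coversMids e∈E (proj₂ (∈-trace⁻ e₁∈)) (proj₂ (∈-trace⁻ e₂∈))

-- Flips

toggles : ∀ {k} → Fin k × Fin k → Fin k → Fin k → Bool
toggles (i , j) a b = (⌊ a ≟ i ⌋ ∧ ⌊ b ≟ j ⌋) ∨ (⌊ a ≟ j ⌋ ∧ ⌊ b ≟ i ⌋)

parity : ∀ {k} → List (Fin k × Fin k) → Fin k → Fin k → Bool
parity []       a b = false
parity (f ∷ fs) a b = parity fs a b xor toggles f a b

toggles-sym : ∀ {k} (f : Fin k × Fin k) a b → toggles f a b ≡ toggles f b a
toggles-sym (i , j) a b = trans (∨-comm (⌊ a ≟ i ⌋ ∧ ⌊ b ≟ j ⌋) _)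
  (cong₂ _∨_ (∧-comm ⌊ a ≟ j ⌋ _) (∧-comm ⌊ a ≟ i ⌋ _))

parity-sym : ∀ {k} (fs : List (Fin k × Fin k)) a b → parity fs a b ≡ parity fs b a
parity-sym []       a b = refl
parity-sym (f ∷ fs) a b = cong₂ _xor_ (parity-sym fs a b) (toggles-sym f a b)

-- On parts `i` and `j`, `flipBetween` unfolds to `toggles (i , j)` at the parts of the two
-- vertices; what remains is associativity and distributivity of `xor`.
applyFlips-parity : ∀ {m k} (p : Fin m → Fin k) fs E u v →
  applyFlips p fs E u v ≡ E u v xor (not ⌊ u ≟ v ⌋ ∧ parity fs (p u) (p v))
applyFlips-parity p [] E u v =
  sym (trans (cong (E u v xor_) (∧-zeroʳ (not ⌊ u ≟ v ⌋))) (xor-identityʳ (E u v)))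
applyFlips-parity p (f ∷ fs) E u v =
  trans (cong (_xor (not ⌊ u ≟ v ⌋ ∧ toggles f (p u) (p v))) (applyFlips-parity p fs E u v))
    (trans (xor-assoc (E u v) _ _)
      (cong (E u v xor_) (sym (∧-distribˡ-xor (not ⌊ u ≟ v ⌋) _ _))))

toggles-self : ∀ {k} (i j : Fin k) → toggles (i , j) i j ≡ true
toggles-self i j with i ≟ i | j ≟ j
... | yes _  | yes _  = refl
... | yes _  | no j≢j = contradiction refl j≢j
... | no i≢i | _      = contradiction refl i≢i

toggles-other : ∀ {k} (i j a b : Fin k) →
  (a ≡ i × b ≡ j) ⊎ (a ≡ j × b ≡ i) ⊎ toggles (i , j) a b ≡ false
toggles-other i j a b with a ≟ i | b ≟ j | a ≟ j | b ≟ i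
... | yes p | yes q | _     | _     = inj₁ (p , q)
... | _     | _     | yes p | yes q = inj₂ (inj₁ (p , q))
... | yes _ | no _  | yes _ | no _  = inj₂ (inj₂ refl)
... | yes _ | no _  | no _  | _     = inj₂ (inj₂ refl)
... | no _  | _     | yes _ | no _  = inj₂ (inj₂ refl)
... | no _  | _     | no _  | _     = inj₂ (inj₂ refl)

module _ {k} (F : Fin k → Fin k → Bool) (F-sym : ∀ a b → F a b ≡ F b a) where

  -- Wrong pairs are corrected one at a time. Flipping `(i , j)` changes only `(i , j)` and
  -- `(j , i)`, and the symmetry of `F` makes both right at once.
  realise-on : ∀ ps → ∃ λ fs → ∀ {a b} → (a , b) ∈ˡ ps → parity fs a b ≡ F a b
  realise-on [] = [] , λ ()
  realise-on ((i , j) ∷ ps) with realise-on ps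
  ... | fs , agree with parity fs i j ≟ᵇ F i j
  ...   | yes already = fs , λ { (here refl) → already ; (there ab∈) → agree ab∈ }
  ...   | no differ   = (i , j) ∷ fs , λ { (here refl) → self ; {a} {b} (there ab∈) → other a b ab∈ }
    where
    self : parity ((i , j) ∷ fs) i j ≡ F i j
    self rewrite toggles-self i j with parity fs i j | F i j
    ... | true  | true  = contradiction refl differ
    ... | true  | false = refl
    ... | false | true  = refl
    ... | false | false = contradiction refl differ
    other : ∀ a b → (a , b) ∈ˡ ps → parity ((i , j) ∷ fs) a b ≡ F a b
    other a b ab∈ with toggles-other i j a b
    ... | inj₁ (refl , refl)        = self
    ... | inj₂ (inj₁ (refl , refl)) = trans (parity-sym ((i , j) ∷ fs) j i) (trans self (F-sym i j))
    ... | inj₂ (inj₂ untouched) rewrite untouched = trans (xor-identityʳ _) (agree ab∈)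

  realise : ∃ λ fs → ∀ a b → parity fs a b ≡ F a b
  realise with fs , agree ← realise-on (cartesianProduct (allFin k) (allFin k)) =
    fs , λ a b → agree (∈-cartesianProduct⁺ (∈-allFin a) (∈-allFin b))

-- From cops to flips

-- Inclusion of edges is the direction that turns moves of the runner into moves of the robber.
Detached : (G : Graph) → Subset (n G) → (Fin (n G) → Fin (n G) → Bool) → Set
Detached G C H = ∀ {u v} → H u v ≡ true → u ∉ C × v ∉ C × adj G u v ≡ true

detached⇒isolated : ∀ G {C H} → Detached G C H → ∀ {x} → x ∈ C → Isolated H x
detached⇒isolated G {H = H} det {x} x∈C y with H x y in eq
... | false = refl
... | true  = contradiction x∈C (proj₁ (det eq))

-- No edge of `H` meets `C`, so the walk avoids all of `C`, whatever the next cop set `D` is.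
detached-walk : ∀ G {C H} → Detached G C H → ∀ {r x y} → x ∉ C → (D : Subset (n G)) →
                Walk H ⊥ r x y → Walk (adj G) (C ∩ D) r x y
detached-walk G {C} det x∉C D (stay _) = stay λ x∈ → x∉C (proj₁ (x∈p∩q⁻ C D x∈))
detached-walk G {C} det x∉C D (step _ xy walk) with _ , y∉C , xy′ ← det xy =
  step (λ x∈ → x∉C (proj₁ (x∈p∩q⁻ C D x∈))) xy′ (detached-walk G det y∉C D walk)

-- Isolating a cop set by flips between few parts.

module Detach (G : Graph) (C : Subset (n G)) where
  open Traces G C using (V; trace; ∈-trace⁻; ∈-trace⁺; few-traces)

  Code : Set
  Code = V ⊎ Subset (n G)

  code : V → Code
  code v with v ∈? C
  ... | yes _ = inj₁ v
  ... | no _  = inj₂ (trace v)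

  -- The adjacency in `G` of vertices with these codes when at least one lies in `C`. Two trace
  -- codes give `false`, so that edges away from `C` stay unflipped.
  joins : Code → Code → Bool
  joins (inj₁ c) (inj₁ d) = adj G c d
  joins (inj₁ c) (inj₂ t) = lookup t c
  joins (inj₂ t) (inj₁ c) = lookup t c
  joins (inj₂ _) (inj₂ _) = false

  joins-sym : ∀ a b → joins a b ≡ joins b a
  joins-sym (inj₁ c) (inj₁ d) = adj-sym G c d
  joins-sym (inj₁ _) (inj₂ _) = refl
  joins-sym (inj₂ _) (inj₁ _) = refl
  joins-sym (inj₂ _) (inj₂ _) = refl

  lookup-trace : ∀ {v c} → c ∈ C → lookup (trace v) c ≡ adj G v c
  lookup-trace {v} {c} c∈C with adj G v c in eq
  ... | true  = []=⇒lookup (∈-trace⁺ eq c∈C)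
  ... | false = ¬-not λ c∈ →
          contradiction (trans (sym eq) (proj₁ (∈-trace⁻ (lookup⇒[]= c (trace v) c∈)))) λ ()

  -- If `u` or `v` lies in `C`, the flip term equals their adjacency and the `xor` cancels it;
  -- otherwise the flip term is `false`.
  detached-by-codes : (H : V → V → Bool) →
    (∀ u v → H u v ≡ adj G u v xor (not ⌊ u ≟ v ⌋ ∧ joins (code u) (code v))) → Detached G C H
  detached-by-codes H H≡ {u} {v} Huv with trans (sym (H≡ u v)) Huv
  ... | eq with u ≟ v
  ...   | yes refl rewrite irrefl G u = contradiction eq λ ()
  ...   | no _ with u ∈? C | v ∈? C
  ...     | yes _   | yes _   = contradiction (trans (sym eq) (xor-same (adj G u v))) λ ()
  ...     | yes u∈C | no _    rewrite lookup-trace {v} u∈C | adj-sym G v u =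
              contradiction (trans (sym eq) (xor-same (adj G u v))) λ ()
  ...     | no _    | yes v∈C rewrite lookup-trace {u} v∈C =
              contradiction (trans (sym eq) (xor-same (adj G u v))) λ ()
  ...     | no u∉C  | no v∉C  = u∉C , v∉C , trans (sym (xor-identityʳ (adj G u v))) eq

  few-codes : ∀ {k} → CopsWinGame G 2 k →
              ∃ λ L → length L ≤ ∣ C ∣ + suc (∣ C ∣ * (k + 2 ^ k)) × (∀ v → code v ∈ˡ L)
  few-codes cops with T , length-T , covers ← few-traces cops =
    map inj₁ (members C) ++ map inj₂ T ,
    ≤-trans (≤-reflexive (length-++ (map inj₁ (members C))))
      (+-mono-≤ (≤-trans (≤-reflexive (length-map inj₁ (members C))) (length-members C))
                (≤-trans (≤-reflexive (length-map inj₂ T)) length-T)) ,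
    code∈
    where
    code∈ : ∀ v → code v ∈ˡ map inj₁ (members C) ++ map inj₂ T
    code∈ v with v ∈? C
    ... | yes v∈C = ∈-++⁺ˡ (∈-map⁺ inj₁ (∈-members⁺ v∈C))
    ... | no v∉C  = ∈-++⁺ʳ (map inj₁ (members C)) (∈-map⁺ inj₂ (covers v∉C))

  -- Parts are indexed by codes, and `joins` is the symmetric table of pairs of parts to be flipped.
  detach : ∀ {k K} → CopsWinGame G 2 k → ∣ C ∣ + suc (∣ C ∣ * (k + 2 ^ k)) ≤ K →
           Σ (V → Fin K) λ p → ∃ λ fs → Detached G C (applyFlips p fs (adj G))
  detach {K = K} cops bound with L , length-L , code∈ ← few-codes cops
    with decode , onto ← enumerate (inj₂ ⊥) L (≤-trans length-L bound)
    with fs , agree ← realise (λ a b → joins (decode a) (decode b)) (λ a b → joins-sym (decode a) (decode b)) =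
    p , fs , detached-by-codes _ λ u v → trans (applyFlips-parity p fs (adj G) u v)
      (cong (λ b → adj G u v xor (not ⌊ u ≟ v ⌋ ∧ b))
        (trans (agree (p u) (p v)) (cong₂ joins (decode-p u) (decode-p v))))
    where
    p : V → Fin K
    p v = proj₁ (onto (code∈ v))
    decode-p : ∀ v → decode (p v) ≡ code v
    decode-p v = proj₂ (onto (code∈ v))

-- Transferring the strategy of the cops to the flipper.

module Simulation (G : Graph) {r k K : ℕ}
  (detach : ∀ C → ∣ C ∣ ≤ k →
            Σ (Fin (n G) → Fin K) λ p → ∃ λ fs → Detached G C (applyFlips p fs (adj G))) where

  -- Invariant: the current graph isolates `C` and the runner is off `C`. The next walk is then
  -- legal for the robber, and a runner who ends in `C′` is isolated in the new graph.
  imitate : ∀ {C H x} → Detached G C H → x ∉ C → CopsWin G r k C x → FlipperWins G r K H x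
  imitate {C} {H} {x} det x∉C (move C′ ∣C′∣≤k next) with detach C′ ∣C′∣≤k
  ... | p , fs , det′ = move p fs respond
    where
    respond : ∀ y → Walk H ⊥ r x y → Isolated (applyFlips p fs (adj G)) y ⊎
                                     FlipperWins G r K (applyFlips p fs (adj G)) y
    respond y walk with y ∈? C′ | next y (detached-walk G det x∉C C′ walk)
    ... | yes y∈C′ | _         = inj₁ (detached⇒isolated G det′ y∈C′)
    ... | no y∉C′  | inj₁ y∈C′ = contradiction y∈C′ y∉C′
    ... | no y∉C′  | inj₂ wins = inj₂ (imitate det′ y∉C′ wins)

  -- The runner's first walk is in `G` itself, so the first flip only sets up `C₀`. Wherever that
  -- walk ends is taken as the robber's starting vertex, which `wins` allows to be arbitrary.
  flipper-wins : CopsWinGame G r k → FlipperWinsGame G r K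
  flipper-wins (C₀ , ∣C₀∣≤k , wins) x with p , fs , det ← detach C₀ ∣C₀∣≤k = move p fs respond
    where
    respond : ∀ y → Walk (adj G) ⊥ r x y → Isolated (applyFlips p fs (adj G)) y ⊎
                                           FlipperWins G r K (applyFlips p fs (adj G)) y
    respond y _ with y ∈? C₀
    ... | yes y∈C₀ = inj₁ (detached⇒isolated G det y∈C₀)
    ... | no y∉C₀  = inj₂ (imitate det y∉C₀ (wins y))

-- Only `s` grows with the radius; the exponential factor depends on `k`, which is at most `c * 2`.
-- The additive one is absorbed by `r`.
width-bound : ∀ {s k c r} → 1 ≤ r → s ≤ c * r → k ≤ c * 2 →
  s + suc (s * (k + 2 ^ k)) ≤ suc (c + c * (c * 2 + 2 ^ (c * 2))) * r
width-bound {s} {k} {c} {r} 1≤r s≤cr k≤2c = begin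
  s + suc (s * (k + 2 ^ k))                  ≤⟨ +-mono-≤ s≤cr (+-mono-≤ 1≤r
                                                  (*-mono-≤ s≤cr (+-mono-≤ k≤2c (^-monoʳ-≤ 2 k≤2c)))) ⟩
  c * r + (r + c * r * (c * 2 + 2 ^ (c * 2))) ≡⟨ solve 3 (λ c r b → c :* r :+ (r :+ c :* r :* b)
                                                  := (con 1 :+ (c :+ c :* b)) :* r)
                                                  refl c r (c * 2 + 2 ^ (c * 2)) ⟩
  suc (c + c * (c * 2 + 2 ^ (c * 2))) * r    ∎
  where
  open ≤-Reasoning
  open +-*-Solver

theorem4 : (𝒢 : Graph → Set) → IsoClosed 𝒢 →
    Σ ℕ (λ c → ∀ (r : ℕ) → 1 ≤ r → ∀ G → 𝒢 G → cw≤ r G (c * r)) →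
    Σ ℕ (λ c' → ∀ (r : ℕ) → 1 ≤ r → ∀ G → 𝒢 G → fw≤ r G (c' * r))
-- The cop bound enters twice: radius `r` supplies the strategy to imitate, radius 2 bounds the
-- traces on each cop set.
theorem4 𝒢 _ (c , cops) = c′ , λ r 1≤r G G∈𝒢 → flips r 1≤r G (cops r 1≤r G G∈𝒢) (cops 2 (s≤s z≤n) G G∈𝒢)
  where
  c′ : ℕ
  c′ = suc (c + c * (c * 2 + 2 ^ (c * 2)))
  flips : ∀ r → 1 ≤ r → ∀ G → cw≤ r G (c * r) → cw≤ 2 G (c * 2) → fw≤ r G (c′ * r)
  flips r 1≤r G (l , _ , l≤cr , copsʳ) (k , _ , k≤2c , cops²) =
    c′ * r , ≤-trans 1≤r (m≤m+n r _) , ≤-refl ,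
    Simulation.flipper-wins G
      (λ C ∣C∣≤l → Detach.detach G C cops² (width-bound {c = c} 1≤r (≤-trans ∣C∣≤l l≤cr) k≤2c)) copsʳ
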